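{- For every integer $l \ge 1$, the resolving independent domination number of the fractal cubic network $FCN(l)$ satisfies $\gamma_{ri}(FCN(l)) = 4\,\gamma_2(FCN(l-1))$, where $\gamma_2$ denotes the 2-domination number.
   Context: Fractal cubic network: for an integer $l\ge 0$, $FCN(l)$ is the finite simple graph whose vertices are all binary strings of length $2l+2$, defined recursively as follows. $FCN(0)$ is the 4-cycle with vertices $00, 01, 11, 10$ in this cyclic order. For $l\ge 1$, $FCN(l)$ is obtained from the disjoint union of the four copies $ab\,\Vert\,FCN(l-1)$, $a,b\in\{0,1\}$ (each vertex string of $FCN(l-1)$ is prefixed by $ab$, adjacency inside a copy being that of $FCN(l-1)$), by adding the four edges $\{00w,10w\}$, $\{10w,11w\}$, $\{11w,01w\}$, $\{01w,00w\}$, where $w=10(01)^{l-1}$ is the string $10$ followed by $l-1$ repetitions of $01$. A set $R\subseteq V(\Gamma)$ of a connected graph $\Gamma$ is a resolving set if for every two distinct vertices $g,h$ there is $r\in R$ with $d(g,r)\ne d(h,r)$ (graph distance). An independent dominating set is a set $D\subseteq V(\Gamma)$ such that every vertex is in $D$ or adjacent to a vertex of $D$, and no two vertices of $D$ are adjacent. A resolving independent dominating set is a set that is both a resolving set and an independent dominating set; $\gamma_{ri}(\Gamma)$ is the minimum size of such a set. A 2-dominating set is a set $D$ such that every $v\in V(\Gamma)\setminus D$ has at least two neighbors in $D$; $\gamma_2(\Gamma)$ is the minimum size of a 2-dominating set. -}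

module Defs where

open import Data.Bool.Base using (Bool; true; false)
open import Data.List.Base using (List; length)
open import Data.List.Membership.Propositional using () renaming (_∈_ to _∈ₗ_)
open import Data.List.Relation.Unary.Unique.Propositional using (Unique)
open import Data.Nat.Base using (ℕ; zero; suc; _+_; _*_; _≤_)
open import Data.Nat.Properties using (≤-antisym)
open import Data.Product using (∃; ∃-syntax; _×_; _,_)
open import Data.Sum.Base using (_⊎_; inj₁; inj₂)
open import Data.Vec.Base using (Vec; []; _∷_; concat; replicate)
open import Relation.Binary.Core using (Rel)
open import Relation.Binary.Definitions using (Symmetric; Irreflexive)
open import Relation.Binary.Construct.Closure.Symmetric as Sym
  using (SymClosure; fwd; bwd)
open import Relation.Binary.PropositionalEquality
  using (_≡_; _≢_; refl; sym)
open import Relation.Nullary.Negation.Core using (¬_)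
open import Relation.Unary using (Pred)
open import Level using (0ℓ)

-- Distances and domination numbers are relations rather than functions:
-- IsLeast P n holds for at most one n.

IsLeast : Pred ℕ 0ℓ → Pred ℕ 0ℓ
IsLeast P n = P n × (∀ m → P m → n ≤ m)

IsLeast-unique : ∀ {P m n} → IsLeast P m → IsLeast P n → m ≡ n
IsLeast-unique (Pm , m≤) (Pn , n≤) = ≤-antisym (m≤ _ Pn) (n≤ _ Pm)

record FinSet (A : Set) : Set where
  field
    elements : List A
    unique   : Unique elements

open FinSet public

infix 4 _∈_ _∉_

_∈_ _∉_ : {A : Set} → A → FinSet A → Set
x ∈ S = x ∈ₗ elements S
x ∉ S = ¬ (x ∈ S)

∣_∣ : {A : Set} → FinSet A → ℕ
∣ S ∣ = length (elements S)

record Graph : Set₁ where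
  infix 4 _~_
  field
    Vertex   : Set
    _~_      : Rel Vertex 0ℓ
    ~-sym    : Symmetric _~_
    ~-irrefl : Irreflexive _≡_ _~_

module _ (Γ : Graph) where
  open Graph Γ

  data Walk : ℕ → Vertex → Vertex → Set where
    nil  : ∀ {u} → Walk 0 u u
    cons : ∀ {n u v w} → u ~ v → Walk n v w → Walk (suc n) u w

  Connected : Set
  Connected = ∀ u v → ∃[ n ] Walk n u v

  IsDistance : Vertex → Vertex → ℕ → Set
  IsDistance u v = IsLeast (λ n → Walk n u v)

  -- m and n are d(g,r) and d(h,r), which exist when the graph is connected.
  Resolving : FinSet Vertex → Set
  Resolving R = ∀ g h → g ≢ h →
    ∃[ r ] r ∈ R × ∃[ m ] ∃[ n ] IsDistance g r m × IsDistance h r n × m ≢ n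

  Dominating : FinSet Vertex → Set
  Dominating D = ∀ v → v ∈ D ⊎ (∃[ u ] u ∈ D × v ~ u)

  Independent : FinSet Vertex → Set
  Independent D = ∀ u v → u ∈ D → v ∈ D → ¬ (u ~ v)

  ResolvingIndependentDominating : FinSet Vertex → Set
  ResolvingIndependentDominating D = Resolving D × Independent D × Dominating D

  TwoDominating : FinSet Vertex → Set
  TwoDominating D = ∀ v → v ∉ D →
    ∃[ x ] ∃[ y ] x ≢ y × (x ∈ D × v ~ x) × (y ∈ D × v ~ y)

  IsMinimumSize : Pred (FinSet Vertex) 0ℓ → ℕ → Set
  IsMinimumSize P = IsLeast (λ n → ∃[ S ] P S × ∣ S ∣ ≡ n)

  Isγri : ℕ → Set
  Isγri = IsMinimumSize ResolvingIndependentDominating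

  Isγ₂ : ℕ → Set
  Isγ₂ = IsMinimumSize TwoDominating

pattern 0b = false
pattern 1b = true

-- The length is written 2 + l * 2 so that prefixing two bits to a string of
-- level l gives a string of level l + 1 definitionally.

BitString : ℕ → Set
BitString l = Vec Bool (2 + l * 2)

data Arc : Rel (Vec Bool 2) 0ℓ where
  00→01 : Arc (0b ∷ 0b ∷ []) (0b ∷ 1b ∷ [])
  01→11 : Arc (0b ∷ 1b ∷ []) (1b ∷ 1b ∷ [])
  11→10 : Arc (1b ∷ 1b ∷ []) (1b ∷ 0b ∷ [])
  10→00 : Arc (1b ∷ 0b ∷ []) (0b ∷ 0b ∷ [])

C₄ : Rel (Vec Bool 2) 0ℓ
C₄ = SymClosure Arc

-- port l = 10(01)^l is the vertex of FCN l that carries the new edges when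
-- four copies of FCN l are joined to form FCN (l + 1).

port : ∀ l → BitString l
port l = 1b ∷ 0b ∷ concat (replicate l (0b ∷ 1b ∷ []))

-- The four new edges {00w,10w}, {10w,11w}, {11w,01w}, {01w,00w} join the
-- prefixes in the same undirected 4-cycle 00, 01, 11, 10 as FCN 0.

Adjacent : ∀ l → Rel (BitString l) 0ℓ
Adjacent zero    u v = C₄ u v
Adjacent (suc l) (a ∷ b ∷ u) (c ∷ d ∷ v) =
    ((a ≡ c × b ≡ d) × Adjacent l u v)
  ⊎ (C₄ (a ∷ b ∷ []) (c ∷ d ∷ []) × u ≡ port l × v ≡ port l)

C₄-sym : Symmetric C₄
C₄-sym = Sym.symmetric Arc

C₄-irrefl : Irreflexive _≡_ C₄
C₄-irrefl refl (fwd ())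
C₄-irrefl refl (bwd ())

Adjacent-sym : ∀ l → Symmetric (Adjacent l)
Adjacent-sym zero    e = C₄-sym e
Adjacent-sym (suc l) {_ ∷ _ ∷ _} {_ ∷ _ ∷ _} (inj₁ ((p , q) , e)) =
  inj₁ ((sym p , sym q) , Adjacent-sym l e)
Adjacent-sym (suc l) {_ ∷ _ ∷ _} {_ ∷ _ ∷ _} (inj₂ (e , p , q)) =
  inj₂ (C₄-sym e , q , p)

Adjacent-irrefl : ∀ l → Irreflexive _≡_ (Adjacent l)
Adjacent-irrefl zero    p e = C₄-irrefl p e
Adjacent-irrefl (suc l) {_ ∷ _ ∷ _} refl (inj₁ (_ , e)) = Adjacent-irrefl l refl e
Adjacent-irrefl (suc l) {_ ∷ _ ∷ _} refl (inj₂ (e , _)) = C₄-irrefl refl e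

FCN : ℕ → Graph
FCN l = record
  { Vertex   = BitString l
  ; _~_      = Adjacent l
  ; ~-sym    = Adjacent-sym l
  ; ~-irrefl = Adjacent-irrefl l
  }

_++ʷ_ : ∀ {Γ m n u v w} → Walk Γ m u v → Walk Γ n v w → Walk Γ (m + n) u w
nil      ++ʷ q = q
cons e p ++ʷ q = cons e (p ++ʷ q)

C₄-connected : Connected (FCN 0)
C₄-connected u v =
  let _ , p = to00 u
      _ , q = from00 v
  in  _ , p ++ʷ q
  where
  to00 : ∀ u → ∃[ n ] Walk (FCN 0) n u (0b ∷ 0b ∷ [])
  to00 (0b ∷ 0b ∷ []) = _ , nil
  to00 (0b ∷ 1b ∷ []) = _ , cons (bwd 00→01) nil
  to00 (1b ∷ 0b ∷ []) = _ , cons (fwd 10→00) nil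
  to00 (1b ∷ 1b ∷ []) = _ , cons (fwd 11→10) (cons (fwd 10→00) nil)

  from00 : ∀ u → ∃[ n ] Walk (FCN 0) n (0b ∷ 0b ∷ []) u
  from00 (0b ∷ 0b ∷ []) = _ , nil
  from00 (0b ∷ 1b ∷ []) = _ , cons (fwd 00→01) nil
  from00 (1b ∷ 0b ∷ []) = _ , cons (bwd 10→00) nil
  from00 (1b ∷ 1b ∷ []) = _ , cons (bwd 10→00) (cons (bwd 11→10) nil)

FCN-connected : ∀ l → Connected (FCN l)
FCN-connected zero = C₄-connected
FCN-connected (suc l) (a ∷ b ∷ u) (c ∷ d ∷ v) =
  let _ , p = FCN-connected l u (port l)
      _ , q = C₄-connected (a ∷ b ∷ []) (c ∷ d ∷ [])
      _ , r = FCN-connected l (port l) v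
  in  _ , copy p ++ʷ (link q ++ʷ copy r)
  where
  copy : ∀ {n a b u v} → Walk (FCN l) n u v →
         Walk (FCN (suc l)) n (a ∷ b ∷ u) (a ∷ b ∷ v)
  copy nil        = nil
  copy (cons e p) = cons (inj₁ ((refl , refl) , e)) (copy p)

  link : ∀ {n a b c d} → Walk (FCN 0) n (a ∷ b ∷ []) (c ∷ d ∷ []) →
         Walk (FCN (suc l)) n (a ∷ b ∷ port l) (c ∷ d ∷ port l)
  link nil                          = nil
  link (cons {v = _ ∷ _ ∷ []} e p) = cons (inj₂ (e , refl , refl)) (link p)

{-# OPTIONS --safe #-}

-- Dropping the last two bits of a vertex partitions FCN l into 4-cycles. In
-- each of them 00 and 11 are never ports, so they have degree 2 and the same
-- two neighbours 01 and 10.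
--
-- Every 4-cycle meets a 2-dominating set twice, since a missing 00 or 11 forces
-- both 01 and 10. It also meets a resolving dominating set twice: the twins 00
-- and 11 cannot both be missing, and if one is, it is dominated by 01 or 10.
--
-- Conversely, the vertices ending in 00 or 11 form an independent 2-dominating
-- set, which is resolving for l ≥ 1. Outside it, vertices of different 4-cycles
-- are separated by a neighbour of one of them. Two vertices p01 and p10 of one
-- 4-cycle are separated by p′00, where p′ is a neighbouring 4-cycle attached to
-- p at p10: p10 has distance 2 from p′00, and p01 is farther away.
module Submission where

open import Defs
open import Data.Bool.Base using (Bool; not)
open import Data.Bool.Properties using (_≟_; not-¬)
open import Data.List.Base using (List; []; _∷_; [_]; length; cartesianProductWith)
open import Data.List.Properties using (filter-notAll)
open import Data.List.Membership.Propositional using (lose)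
  renaming (_∈_ to _∈ₗ_)
open import Data.List.Membership.Propositional.Properties
  using (∈-filter⁺; ∈-cartesianProductWith⁺; ∈-cartesianProductWith⁻)
open import Data.List.Relation.Binary.Subset.Propositional using (_⊆_)
import Data.List.Relation.Unary.All as All
import Data.List.Relation.Unary.AllPairs as AllPairs
import Data.List.Relation.Unary.Any as Any
open Any using (here; there)
open import Data.List.Relation.Unary.Unique.Propositional using (Unique)
open import Data.List.Relation.Unary.Unique.Propositional.Properties
  using (cartesianProductWith⁺)
open import Data.Nat.Base using (ℕ; zero; suc; _+_; _≤_; z≤n; s≤s; _*_; _∸_)
open import Data.Nat.Properties
  using (≤-trans; ≤-antisym; *-assoc; *-comm; module ≤-Reasoning)
open import Data.Product using (∃; ∃-syntax; _×_; _,_; proj₁; proj₂)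
open import Data.Sum.Base using (inj₁; inj₂; [_,_]′)
open import Data.Vec.Base using (Vec; []; _∷_; concat; replicate)
open import Data.Vec.Properties using (≡-dec; ∷-injectiveˡ; ∷-injectiveʳ)
open import Function.Base using (_∘_)
open import Relation.Binary.Construct.Closure.Symmetric using (fwd; bwd)
open import Relation.Binary.Definitions using (Decidable; DecidableEquality)
open import Relation.Binary.PropositionalEquality
  using (_≡_; _≢_; refl; sym; trans; cong; module ≡-Reasoning)
open import Relation.Nullary.Decidable using (Dec; yes; no; map′; _×-dec_; _⊎-dec_; ¬?)
open import Relation.Nullary.Negation.Core using (¬_; contradiction)
open import Relation.Unary as Unary using (Pred)
open import Level using (0ℓ)

-- Finite counting and least numbers.

-- Deleting `x` from `ys` shortens it, and by uniqueness the rest of `xs` survives the deletion.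
length-mono-⊆ : {A : Set} → DecidableEquality A → {xs ys : List A} →
                Unique xs → xs ⊆ ys → length xs ≤ length ys
length-mono-⊆ _≟ᴬ_ AllPairs.[] _ = z≤n
length-mono-⊆ _≟ᴬ_ {x ∷ xs} {ys} (x∉xs AllPairs.∷ uniq) xs⊆ys =
  ≤-trans
    (s≤s (length-mono-⊆ _≟ᴬ_ uniq λ z∈xs →
      ∈-filter⁺ ≢x? (xs⊆ys (there z∈xs)) (All.lookup x∉xs z∈xs)))
    (filter-notAll ≢x? ys (lose (xs⊆ys (here refl)) λ x≢x → x≢x refl))
  where
  ≢x? : Unary.Decidable (x ≢_)
  ≢x? = ¬? ∘ (x ≟ᴬ_)

-- Search upwards from 0; the known witness `n` bounds the search.
least : {P : Pred ℕ 0ℓ} → Unary.Decidable P → ∀ n → P n → ∃[ m ] IsLeast P m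
least P? zero    Pn = 0 , Pn , λ _ _ → z≤n
least P? (suc n) Pn with P? 0
... | yes P0 = 0 , P0 , λ _ _ → z≤n
... | no ¬P0 with m , Pm , m≤ ← least (P? ∘ suc) n Pn =
  suc m , Pm , λ where
    zero    P0 → contradiction P0 ¬P0
    (suc k) Pk → s≤s (m≤ k Pk)

-- Enumeration of bit strings.

bits : List Bool
bits = 0b ∷ 1b ∷ []

∈-bits : ∀ b → b ∈ₗ bits
∈-bits 0b = here refl
∈-bits 1b = there (here refl)

bits-unique : Unique bits
bits-unique = ((λ ()) All.∷ All.[]) AllPairs.∷ All.[] AllPairs.∷ AllPairs.[]

length-product-bits : {A B : Set} (f : A → Bool → B) (xs : List A) →
                      length (cartesianProductWith f xs bits) ≡ length xs * 2
length-product-bits f []       = refl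
length-product-bits f (x ∷ xs) = cong (2 +_) (length-product-bits f xs)

strings : ∀ n → List (Vec Bool n)
strings zero    = [ [] ]
strings (suc n) = cartesianProductWith (λ v b → b ∷ v) (strings n) bits

∈-strings : ∀ {n} (v : Vec Bool n) → v ∈ₗ strings n
∈-strings []      = here refl
∈-strings (b ∷ v) = ∈-cartesianProductWith⁺ _ (∈-strings v) (∈-bits b)

strings-unique : ∀ n → Unique (strings n)
strings-unique zero    = All.[] AllPairs.∷ AllPairs.[]
strings-unique (suc n) = cartesianProductWith⁺ (λ v b → b ∷ v)
  (λ eq → ∷-injectiveʳ eq , ∷-injectiveˡ eq) (strings-unique n) bits-unique

_≟ᵛ_ : ∀ {n} → DecidableEquality (Vec Bool n)
_≟ᵛ_ = ≡-dec _≟_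

anyString? : ∀ {n} {P : Pred (Vec Bool n) 0ℓ} → Unary.Decidable P → Dec (∃ P)
anyString? P? =
  map′ Any.satisfied (λ (v , Pv) → lose (∈-strings v) Pv) (Any.any? P? (strings _))

-- Decidable adjacency and existence of distances.

arc : ∀ a b → Arc (a ∷ b ∷ []) (b ∷ not a ∷ [])
arc 0b 0b = 00→01
arc 0b 1b = 01→11
arc 1b 0b = 10→00
arc 1b 1b = 11→10

-- The arcs are the graph of the quarter turn sending `a b` to `b (not a)`, so equality of strings
-- decides them.
arc? : Decidable Arc
arc? (a ∷ b ∷ []) v =
  map′ (λ { refl → arc a b })
       (λ { 00→01 → refl ; 01→11 → refl ; 11→10 → refl ; 10→00 → refl })
       (v ≟ᵛ (b ∷ not a ∷ []))

C₄? : Decidable C₄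
C₄? u v = map′ [ fwd , bwd ]′ (λ { (fwd e) → inj₁ e ; (bwd e) → inj₂ e })
               (arc? u v ⊎-dec arc? v u)

adjacent? : ∀ l → Decidable (Adjacent l)
adjacent? zero    u v = C₄? u v
adjacent? (suc l) (a ∷ b ∷ u) (c ∷ d ∷ v) =
  ((a ≟ c ×-dec b ≟ d) ×-dec adjacent? l u v) ⊎-dec
  (C₄? (a ∷ b ∷ []) (c ∷ d ∷ []) ×-dec u ≟ᵛ port l ×-dec v ≟ᵛ port l)

walk? : ∀ l n → Decidable (Walk (FCN l) n)
walk? l zero    u v = map′ (λ { refl → nil }) (λ { nil → refl }) (u ≟ᵛ v)
walk? l (suc n) u v =
  map′ (λ { (_ , e , w) → cons e w }) (λ { (cons e w) → _ , e , w })
       (anyString? λ x → adjacent? l u x ×-dec walk? l n x v)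

distance : ∀ l u v → ∃[ n ] IsDistance (FCN l) u v n
distance l u v with n , w ← FCN-connected l u v = least (λ k → walk? l k u v) n w

-- Separation of two vertices by a third.

Separates : ∀ l (r g h : BitString l) → Set
Separates l r g h =
  ∃[ m ] ∃[ n ] IsDistance (FCN l) g r m × IsDistance (FCN l) h r n × m ≢ n

separates-sym : ∀ l {r g h} → Separates l r g h → Separates l r h g
separates-sym l (m , n , dm , dn , m≢n) = n , m , dn , dm , m≢n ∘ sym

-- No exact distance is computed: were the two equal, a shortest walk from `h` would have length at
-- most `k`.
closer⇒separates : ∀ l {r g h} k → Walk (FCN l) k g r →
                   (∀ {j} → j ≤ k → ¬ Walk (FCN l) j h r) → Separates l r g h
closer⇒separates l {r} {g} {h} k w far
  with m , dm ← distance l g r | n , dn ← distance l h r =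
  m , n , dm , dn , λ { refl → far (proj₂ dm k w) (proj₁ dn) }

-- Decomposition into 4-cycles.

-- The 4-cycle is named by `p`, its vertex by `x`. Plain concatenation would have length
-- `l * 2 + 2`, which is not definitionally that of `BitString l`.
leaf : ∀ l → Vec Bool (l * 2) → Vec Bool 2 → BitString l
leaf zero    []          x = x
leaf (suc l) (a ∷ b ∷ p) x = a ∷ b ∷ leaf l p x

leaf-injective : ∀ l {p q x y} → leaf l p x ≡ leaf l q y → p ≡ q × x ≡ y
leaf-injective zero    {[]}        {[]}        eq = refl , eq
leaf-injective (suc l) {a ∷ b ∷ p} {c ∷ d ∷ q} eq
  with refl ← ∷-injectiveˡ eq
     | refl ← ∷-injectiveˡ (∷-injectiveʳ eq)
     | refl , x≡y ← leaf-injective l {p} {q} (∷-injectiveʳ (∷-injectiveʳ eq)) =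
  refl , x≡y

corner side : Bool → Vec Bool 2
corner b = b ∷ b ∷ []
side   b = b ∷ not b ∷ []

corner≢side : ∀ {b c} → corner b ≢ side c
corner≢side {0b} {0b} ()
corner≢side {1b} {1b} ()

data View l : BitString l → Set where
  atCorner : ∀ p b → View l (leaf l p (corner b))
  atSide   : ∀ p b → View l (leaf l p (side b))

view : ∀ l v → View l v
view zero (0b ∷ 0b ∷ []) = atCorner [] 0b
view zero (0b ∷ 1b ∷ []) = atSide [] 0b
view zero (1b ∷ 0b ∷ []) = atSide [] 1b
view zero (1b ∷ 1b ∷ []) = atCorner [] 1b
view (suc l) (a ∷ b ∷ v) with view l v
... | atCorner p c = atCorner (a ∷ b ∷ p) c
... | atSide p c   = atSide (a ∷ b ∷ p) c

corner≢port : ∀ l p b → leaf l p (corner b) ≢ port l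
corner≢port l p b = go l p 1b
  where
  -- The port starts with 10 but continues with 01; both have the form `a (not a)`, which makes the
  -- induction go through.
  go : ∀ l p a → leaf l p (corner b) ≢ a ∷ not a ∷ concat (replicate l (0b ∷ 1b ∷ []))
  go zero    []          a eq = corner≢side eq
  go (suc l) (c ∷ d ∷ p) a eq = go l p 0b (∷-injectiveʳ (∷-injectiveʳ eq))

-- Link edges end only at ports, so every edge at a corner stays inside its 4-cycle.
corner-neighbour : ∀ l p b {v} → Adjacent l (leaf l p (corner b)) v →
                   ∃[ c ] v ≡ leaf l p (side c)
corner-neighbour zero [] b (fwd 00→01) = 0b , refl
corner-neighbour zero [] b (fwd 11→10) = 1b , refl
corner-neighbour zero [] b (bwd 01→11) = 0b , refl
corner-neighbour zero [] b (bwd 10→00) = 1b , refl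
corner-neighbour (suc l) (_ ∷ _ ∷ p) b {_ ∷ _ ∷ _} (inj₁ ((refl , refl) , e))
  with c , refl ← corner-neighbour l p b e = c , refl
corner-neighbour (suc l) (_ ∷ _ ∷ p) b {_ ∷ _ ∷ _} (inj₂ (_ , eq , _)) =
  contradiction eq (corner≢port l p b)

corner~side : ∀ l p b c → Adjacent l (leaf l p (corner b)) (leaf l p (side c))
corner~side zero [] 0b 0b = fwd 00→01
corner~side zero [] 0b 1b = bwd 10→00
corner~side zero [] 1b 0b = bwd 01→11
corner~side zero [] 1b 1b = fwd 11→10
corner~side (suc l) (_ ∷ _ ∷ p) b c = inj₁ ((refl , refl) , corner~side l p b c)

side~corner : ∀ l p b c → Adjacent l (leaf l p (side c)) (leaf l p (corner b))
side~corner l p b c = Adjacent-sym l (corner~side l p b c)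

-- The first step reaches a side, which is adjacent to both corners, so only the starting vertex has
-- to be exchanged.
corner-twins : ∀ l p {b} c {n r} → Walk (FCN l) (suc n) (leaf l p (corner b)) r →
               Walk (FCN l) (suc n) (leaf l p (corner c)) r
corner-twins l p {b} c (cons e w) with d , refl ← corner-neighbour l p b e =
  cons (corner~side l p c d) w

-- Two vertices per 4-cycle: counting and the lower bound.

selection : ∀ l (f : Vec Bool (l * 2) → Bool → Vec Bool 2) →
            (∀ p → f p 0b ≢ f p 1b) → FinSet (BitString l)
selection l f distinct = record
  { elements = cartesianProductWith (λ p b → leaf l p (f p b)) (strings (l * 2)) bits
  ; unique   = cartesianProductWith⁺ _ injective (strings-unique (l * 2)) bits-unique
  }
  where
  f-injective : ∀ p {b c} → f p b ≡ f p c → b ≡ c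
  f-injective p {0b} {0b} eq = refl
  f-injective p {0b} {1b} eq = contradiction eq (distinct p)
  f-injective p {1b} {0b} eq = contradiction (sym eq) (distinct p)
  f-injective p {1b} {1b} eq = refl

  injective : ∀ {p q b c} → leaf l p (f p b) ≡ leaf l q (f q c) → p ≡ q × b ≡ c
  injective {p} {q} eq with refl , eq′ ← leaf-injective l {p} {q} eq =
    refl , f-injective p eq′

-- This is twice 4^l, left as a length to match the cardinality of a `selection`.
size : ℕ → ℕ
size l = length (strings (l * 2)) * 2

-- Two further bits double the number of 4-cycles twice, whence the factor 4 of the theorem.
size-suc : ∀ l → size (suc l) ≡ 4 * size l
size-suc l = begin
  length (strings (2 + l * 2)) * 2       ≡⟨ cong (_* 2) (length-strings (1 + l * 2)) ⟩
  length (strings (1 + l * 2)) * 2 * 2   ≡⟨ cong (λ n → n * 2 * 2) (length-strings (l * 2)) ⟩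
  size l * 2 * 2                         ≡⟨ *-assoc (size l) 2 2 ⟩
  size l * 4                             ≡⟨ *-comm (size l) 4 ⟩
  4 * size l                             ∎
  where
  open ≡-Reasoning

  length-strings : ∀ n → length (strings (suc n)) ≡ length (strings n) * 2
  length-strings n = length-product-bits (λ v b → b ∷ v) (strings n)

MeetsTwice : ∀ l → FinSet (BitString l) → Set
MeetsTwice l S =
  ∀ p → ∃[ x ] ∃[ y ] x ≢ y × leaf l p x ∈ S × leaf l p y ∈ S

-- The two chosen vertices of each 4-cycle form a duplicate-free sublist of `S`.
meetsTwice⇒size≤ : ∀ l S → MeetsTwice l S → size l ≤ ∣ S ∣
meetsTwice⇒size≤ l S meets = begin
  size l   ≡⟨ length-product-bits _ (strings (l * 2)) ⟨
  ∣ T ∣    ≤⟨ length-mono-⊆ _≟ᵛ_ (unique T) T⊆S ⟩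
  ∣ S ∣    ∎
  where
  open ≤-Reasoning

  choose : Vec Bool (l * 2) → Bool → Vec Bool 2
  choose p 0b = proj₁ (meets p)
  choose p 1b = proj₁ (proj₂ (meets p))

  choose-∈ : ∀ p b → leaf l p (choose p b) ∈ S
  choose-∈ p 0b with _ , _ , _ , x∈S , _ ← meets p = x∈S
  choose-∈ p 1b with _ , _ , _ , _ , y∈S ← meets p = y∈S

  T : FinSet (BitString l)
  T = selection l choose λ p → proj₁ (proj₂ (proj₂ (meets p)))

  T⊆S : elements T ⊆ elements S
  T⊆S v∈T with p , b , _ , _ , refl ← ∈-cartesianProductWith⁻ _ (strings (l * 2)) bits v∈T =
    choose-∈ p b

_∈?_ : ∀ {n} (v : Vec Bool n) (S : FinSet (Vec Bool n)) → Dec (v ∈ S)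
v ∈? S = Any.any? (v ≟ᵛ_) (elements S)

-- If both corners are present they are the required pair, so only a missing corner needs an
-- argument.
meetsTwice-by-corners : ∀ l S →
  (∀ p b → leaf l p (corner b) ∉ S →
    ∃[ x ] ∃[ y ] x ≢ y × leaf l p x ∈ S × leaf l p y ∈ S) →
  MeetsTwice l S
meetsTwice-by-corners l S missing p
  with leaf l p (corner 0b) ∈? S | leaf l p (corner 1b) ∈? S
... | no 0∉S  | _       = missing p 0b 0∉S
... | yes _   | no 1∉S  = missing p 1b 1∉S
... | yes 0∈S | yes 1∈S = corner 0b , corner 1b , (λ ()) , 0∈S , 1∈S

twoDominating⇒meetsTwice : ∀ l S → TwoDominating (FCN l) S → MeetsTwice l S
twoDominating⇒meetsTwice l S dom = meetsTwice-by-corners l S missing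
  where
  missing : ∀ p b → leaf l p (corner b) ∉ S →
            ∃[ x ] ∃[ y ] x ≢ y × leaf l p x ∈ S × leaf l p y ∈ S
  missing p b v∉S
    with u , w , u≢w , (u∈S , e) , (w∈S , f) ← dom _ v∉S
    with c , refl ← corner-neighbour l p b e | d , refl ← corner-neighbour l p b f =
    side c , side d , u≢w ∘ cong (leaf l p) , u∈S , w∈S

-- Both distances are positive, so shortest walks transfer between the twins in either direction.
corner-unresolved : ∀ l p {b c r} → r ≢ leaf l p (corner b) → r ≢ leaf l p (corner c) →
                    ¬ Separates l r (leaf l p (corner b)) (leaf l p (corner c))
corner-unresolved l p r≢ r≢′ (zero , _ , (nil , _) , _) = r≢ refl
corner-unresolved l p r≢ r≢′ (_ , zero , _ , (nil , _) , _) = r≢′ refl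
corner-unresolved l p r≢ r≢′ (suc m , suc n , (w , m≤) , (w′ , n≤) , m≢n) =
  m≢n (≤-antisym (m≤ _ (corner-twins l p _ w′)) (n≤ _ (corner-twins l p _ w)))

resolvingDominating⇒meetsTwice : ∀ l S → Resolving (FCN l) S → Dominating (FCN l) S →
                                 MeetsTwice l S
resolvingDominating⇒meetsTwice l S res dom = meetsTwice-by-corners l S missing
  where
  missing : ∀ p b → leaf l p (corner b) ∉ S →
            ∃[ x ] ∃[ y ] x ≢ y × leaf l p x ∈ S × leaf l p y ∈ S
  missing p b v∉S with leaf l p (corner (not b)) ∈? S
  ... | no v′∉S
    with r , r∈S , separates ← res _ _ (λ eq →
        not-¬ refl (∷-injectiveˡ (proj₂ (leaf-injective l {p} {p} eq)))) =
    contradiction separates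
      (corner-unresolved l p (λ { refl → v∉S r∈S }) (λ { refl → v′∉S r∈S }))
  -- The twin is one element; the vertex dominating the missing corner must be a side and is the
  -- other.
  ... | yes v′∈S with dom (leaf l p (corner b))
  ...   | inj₁ v∈S = contradiction v∈S v∉S
  ...   | inj₂ (u , u∈S , e) with c , refl ← corner-neighbour l p b e =
    corner (not b) , side c , corner≢side , v′∈S , u∈S

-- The set of all corners: domination and independence.

corners : ∀ l → FinSet (BitString l)
corners l = selection l (λ _ → corner) λ _ ()

∣corners∣ : ∀ l → ∣ corners l ∣ ≡ size l
∣corners∣ l = length-product-bits _ (strings (l * 2))

corner∈corners : ∀ l p b → leaf l p (corner b) ∈ corners l
corner∈corners l p b = ∈-cartesianProductWith⁺ _ (∈-strings p) (∈-bits b)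

side∉corners : ∀ l p b → leaf l p (side b) ∉ corners l
side∉corners l p b v∈
  with q , c , _ , _ , eq ← ∈-cartesianProductWith⁻ _ (strings (l * 2)) bits v∈ =
  corner≢side (sym (proj₂ (leaf-injective l {p} {q} eq)))

corners-twoDominating : ∀ l → TwoDominating (FCN l) (corners l)
corners-twoDominating l v v∉ with view l v
... | atCorner p b = contradiction (corner∈corners l p b) v∉
... | atSide p b =
  leaf l p (corner 0b) , leaf l p (corner 1b) ,
  (λ eq → contradiction (proj₂ (leaf-injective l {p} {p} eq)) λ ()) ,
  (corner∈corners l p 0b , side~corner l p 0b b) ,
  (corner∈corners l p 1b , side~corner l p 1b b)

corners-dominating : ∀ l → Dominating (FCN l) (corners l)
corners-dominating l v with view l v
... | atCorner p b = inj₁ (corner∈corners l p b)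
... | atSide p b   = inj₂ (_ , corner∈corners l p 0b , side~corner l p 0b b)

corners-independent : ∀ l → Independent (FCN l) (corners l)
corners-independent l u v u∈ v∈ e with view l u
... | atSide p b = side∉corners l p b u∈
... | atCorner p b with c , refl ← corner-neighbour l p b e = side∉corners l p c v∈

-- The set of all corners: resolvability.

-- The recursion descends to the copy of `FCN 1` containing the 4-cycle; flipping the first bit
-- there follows one of its link edges.
neighbourLeaf : ∀ l → Vec Bool (suc l * 2) → Vec Bool (suc l * 2)
neighbourLeaf zero    (a ∷ b ∷ []) = not a ∷ b ∷ []
neighbourLeaf (suc l) (a ∷ b ∷ p)  = a ∷ b ∷ neighbourLeaf l p

neighbourLeaf-≢ : ∀ l p → p ≢ neighbourLeaf l p
neighbourLeaf-≢ zero    (a ∷ b ∷ []) eq = not-¬ refl (∷-injectiveˡ eq)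
neighbourLeaf-≢ (suc l) (a ∷ b ∷ p)  eq =
  neighbourLeaf-≢ l p (∷-injectiveʳ (∷-injectiveʳ eq))

side10~neighbourLeaf : ∀ l p → Adjacent (suc l) (leaf (suc l) p (side 1b))
                                                (leaf (suc l) (neighbourLeaf l p) (side 1b))
side10~neighbourLeaf zero (0b ∷ 0b ∷ []) = inj₂ (bwd 10→00 , refl , refl)
side10~neighbourLeaf zero (0b ∷ 1b ∷ []) = inj₂ (fwd 01→11 , refl , refl)
side10~neighbourLeaf zero (1b ∷ 0b ∷ []) = inj₂ (fwd 10→00 , refl , refl)
side10~neighbourLeaf zero (1b ∷ 1b ∷ []) = inj₂ (bwd 01→11 , refl , refl)
side10~neighbourLeaf (suc l) (_ ∷ _ ∷ p) = inj₁ ((refl , refl) , side10~neighbourLeaf l p)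

-- In `FCN 1` link edges end at 10, never at 01; link edges of higher levels join different copies,
-- whereas these two 4-cycles share one.
side01≁neighbourLeaf : ∀ l p x → ¬ Adjacent (suc l) (leaf (suc l) p (side 0b))
                                                    (leaf (suc l) (neighbourLeaf l p) x)
side01≁neighbourLeaf zero (_ ∷ _ ∷ []) x (inj₁ ((eq , _) , _)) = not-¬ refl eq
side01≁neighbourLeaf zero (_ ∷ _ ∷ []) x (inj₂ (_ , () , _))
side01≁neighbourLeaf (suc l) (_ ∷ _ ∷ p) x (inj₁ (_ , e)) = side01≁neighbourLeaf l p x e
side01≁neighbourLeaf (suc l) (_ ∷ _ ∷ p) x (inj₂ (e , _)) = C₄-irrefl refl e

sides-separated : ∀ l p → Separates (suc l) (leaf (suc l) (neighbourLeaf l p) (corner 0b))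
                                            (leaf (suc l) p (side 1b)) (leaf (suc l) p (side 0b))
sides-separated l p = closer⇒separates (suc l) 2
  (cons (side10~neighbourLeaf l p) (cons (side~corner (suc l) q 0b 1b) nil)) (far refl)
  where
  q : Vec Bool (suc l * 2)
  q = neighbourLeaf l p

  step : ∀ {v} → Adjacent (suc l) v (leaf (suc l) q (corner 0b)) →
         ∃[ c ] v ≡ leaf (suc l) q (side c)
  step e = corner-neighbour (suc l) q 0b (Adjacent-sym (suc l) e)

  leaf-≢ : ∀ {x y} → leaf (suc l) p x ≢ leaf (suc l) q y
  leaf-≢ eq = neighbourLeaf-≢ l p (proj₁ (leaf-injective (suc l) eq))

  -- The start is a variable with an equation so that `nil` can be matched; two `leaf` terms would
  -- not unify.
  far : ∀ {j u} → u ≡ leaf (suc l) p (side 0b) → j ≤ 2 →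
         ¬ Walk (FCN (suc l)) j u (leaf (suc l) q (corner 0b))
  far eq _ nil = leaf-≢ (sym eq)
  far eq _ (cons e nil) = leaf-≢ (trans (sym eq) (proj₂ (step e)))
  -- The middle vertex is a side of `q`, so `e` would join `p01` directly to `q`.
  far refl _ (cons e (cons f nil)) with c , refl ← step f =
    side01≁neighbourLeaf l p (side c) e
  far eq (s≤s (s≤s ())) (cons _ (cons _ (cons _ _)))

self-separates : ∀ l {g h} → g ≢ h → Separates l g g h
self-separates l g≢h = closer⇒separates l 0 nil λ { z≤n nil → g≢h refl }

-- All neighbours of a corner lie in its own 4-cycle, so the distances are 1 and at least 2.
leaves-separated : ∀ l {p q} b c → p ≢ q →
  Separates l (leaf l p (corner 0b)) (leaf l p (side b)) (leaf l q (side c))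
leaves-separated l {p} {q} b c p≢q =
  closer⇒separates l 1 (cons (side~corner l p 0b b) nil) (far refl)
  where
  far : ∀ {j u} → u ≡ leaf l q (side c) → j ≤ 1 → ¬ Walk (FCN l) j u (leaf l p (corner 0b))
  far eq _ nil = p≢q (proj₁ (leaf-injective l eq))
  far eq _ (cons e nil) with _ , eq′ ← corner-neighbour l p 0b (Adjacent-sym l e) =
    p≢q (proj₁ (leaf-injective l (trans (sym eq′) eq)))
  far eq (s≤s ()) (cons _ (cons _ _))

-- Level 0 is excluded: in a single 4-cycle both sides have distance 1 from both corners.
corners-resolving : ∀ l → Resolving (FCN (suc l)) (corners (suc l))
corners-resolving l g h g≢h with view (suc l) g | view (suc l) h
... | atCorner p b | _ = _ , corner∈corners (suc l) p b , self-separates (suc l) g≢h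
... | atSide _ _ | atCorner q c =
  _ , corner∈corners (suc l) q c ,
  separates-sym (suc l) (self-separates (suc l) (g≢h ∘ sym))
... | atSide p b | atSide q c with p ≟ᵛ q
...   | no p≢q = _ , corner∈corners (suc l) p 0b , leaves-separated (suc l) b c p≢q
...   | yes refl with b | c
...     | 0b | 0b = contradiction refl g≢h
...     | 1b | 1b = contradiction refl g≢h
...     | 1b | 0b = _ , corner∈corners (suc l) _ 0b , sides-separated l p
...     | 0b | 1b =
  _ , corner∈corners (suc l) _ 0b , separates-sym (suc l) (sides-separated l p)

-- The two minima and their ratio.

γ₂-FCN : ∀ l → Isγ₂ (FCN l) (size l)
γ₂-FCN l =
  (corners l , corners-twoDominating l , ∣corners∣ l) ,
  λ { _ (S , dom , refl) → meetsTwice⇒size≤ l S (twoDominating⇒meetsTwice l S dom) }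

γri-FCN : ∀ l → Isγri (FCN (suc l)) (size (suc l))
γri-FCN l =
  (corners (suc l) ,
   (corners-resolving l , corners-independent (suc l) , corners-dominating (suc l)) ,
   ∣corners∣ (suc l)) ,
  λ { _ (S , (res , _ , dom) , refl) → meetsTwice⇒size≤ (suc l) S
        (resolvingDominating⇒meetsTwice (suc l) S res dom) }

corollary2 : (l : ℕ) → 1 ≤ l →
    ∃[ m ] ∃[ n ] Isγri (FCN l) m × Isγ₂ (FCN (l ∸ 1)) n × m ≡ 4 * n
corollary2 (suc l) (s≤s z≤n) =
  size (suc l) , size l , γri-FCN l , γ₂-FCN l , size-suc l
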